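{- For each integer $p\geq0$, there exists a unique polynomial $Q_p(b,j)$ such that $$\sum_{k=b}^{j-1}\binom{2k+1+p}{2p+1}\binom{2j-1}{j+k}=\binom{2j-1}{j+b}Q_p(b,j)\qquad\text{for integers }j>b\geq0,$$ $$\sum_{k=m}^{b-1}\binom{2k+1+p}{2p+1}(-1)^{k+m}\binom{k+m}{2m}=-(-1)^{b+m}\binom{b+m}{2m}Q_p(b,-m)\qquad\text{for integers }b>m\geq0.$$ The polynomial $Q_p(b,j)$ is of degree $2p+1$ in $b$ and degree $p+1$ in $j$ and satisfies $Q_p(b,-b)=0$. -}

module Defs where

open import Data.Integer as ℤ using (ℤ; +_; -1ℤ)
open import Data.List using (List; []; _∷_; foldr; applyUpTo)
open import Data.Nat as ℕ using (ℕ; zero; suc; _∸_; _<_)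
open import Data.Nat.Combinatorics using (_C_)
open import Data.Product using (_×_; ∃)
open import Data.Rational as ℚ using (ℚ; 0ℚ; _/_)
open import Relation.Binary.PropositionalEquality using (_≡_; _≢_)

-- Coefficient lists, lowest degree first.  Trailing zeros are allowed, so
-- polynomials are compared with _≈_ below rather than with _≡_.
Poly : Set
Poly = List ℚ

-- A polynomial in b whose coefficients are polynomials in j.
Poly₂ : Set
Poly₂ = List Poly

nth : {A : Set} → A → List A → ℕ → A
nth d []       _       = d
nth d (x ∷ _)  zero    = x
nth d (_ ∷ xs) (suc n) = nth d xs n

-- The coefficient of b^r j^s.
coeff : Poly₂ → ℕ → ℕ → ℚ
coeff Q r s = nth 0ℚ (nth [] Q r) s

infix 4 _≈_

_≈_ : Poly₂ → Poly₂ → Set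
Q ≈ Q′ = ∀ r s → coeff Q r s ≡ coeff Q′ r s

eval₁ : Poly → ℚ → ℚ
eval₁ q y = foldr (λ c v → c ℚ.+ y ℚ.* v) 0ℚ q

-- eval Q x y is the value Q(b,j) at b = x, j = y.
eval : Poly₂ → ℚ → ℚ → ℚ
eval Q x y = foldr (λ q v → eval₁ q y ℚ.+ x ℚ.* v) 0ℚ Q

Degree-b : Poly₂ → ℕ → Set
Degree-b Q d = (∃ λ s → coeff Q d s ≢ 0ℚ) × (∀ r s → d < r → coeff Q r s ≡ 0ℚ)

Degree-j : Poly₂ → ℕ → Set
Degree-j Q d = (∃ λ r → coeff Q r d ≢ 0ℚ) × (∀ r s → d < s → coeff Q r s ≡ 0ℚ)

fromℤ : ℤ → ℚ
fromℤ i = i / 1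

fromℕ : ℕ → ℚ
fromℕ n = fromℤ (+ n)

-- The upper bound is exclusive.
sum : ℕ → ℕ → (ℕ → ℤ) → ℤ
sum lo hi f = foldr ℤ._+_ (+ 0) (applyUpTo (λ i → f (lo ℕ.+ i)) (hi ∸ lo))

infix 5 sum

syntax sum lo hi (λ k → t) = ∑[ lo ≤ k < hi ] t

-- The subtraction 2j ∸ 1 never truncates, since j > b ≥ 0.
Identity₁ : ℕ → Poly₂ → Set
Identity₁ p Q = ∀ (b j : ℕ) → b < j →
  fromℤ (∑[ b ≤ k < j ]
    (+ ((2 ℕ.* k ℕ.+ 1 ℕ.+ p) C (2 ℕ.* p ℕ.+ 1)) ℤ.*
     + ((2 ℕ.* j ∸ 1) C (j ℕ.+ k))))
  ≡
  fromℕ ((2 ℕ.* j ∸ 1) C (j ℕ.+ b)) ℚ.* eval Q (fromℕ b) (fromℕ j)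

Identity₂ : ℕ → Poly₂ → Set
Identity₂ p Q = ∀ (b m : ℕ) → m < b →
  fromℤ (∑[ m ≤ k < b ]
    (+ ((2 ℕ.* k ℕ.+ 1 ℕ.+ p) C (2 ℕ.* p ℕ.+ 1)) ℤ.*
     -1ℤ ℤ.^ (k ℕ.+ m) ℤ.*
     + ((k ℕ.+ m) C (2 ℕ.* m))))
  ≡
  fromℤ (ℤ.- (-1ℤ ℤ.^ (b ℕ.+ m)) ℤ.* + ((b ℕ.+ m) C (2 ℕ.* m)))
    ℚ.* eval Q (fromℕ b) (ℚ.- fromℕ m)

{-# OPTIONS --safe #-}
module Submission where

-- Put Q_p(b,j) = (j + b) M(b,j).  By absorption for the binomial coefficients, both
-- sums telescope as soon as
--     (j + b) M(b,j) + (b + 1 − j) M(b+1,j) = C(2b+1+p, 2p+1).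
-- The right side is (2b + 1) A(t), where A is a polynomial of degree p in t = b² + b.  In
-- the Newton basis A = ∑ aᵢ ∏_{m<i} (t − m(m+1)) and M = ∑ rᵢ(j) ∏_{m<i} (b² − m²), the
-- recurrence becomes the triangular system rᵢ = aᵢ + (i+1)(j − i − 1) rᵢ₊₁, which also
-- shows the degrees.  Uniqueness holds because Q is determined on all integers j > b ≥ 0.

import Algebra.Solver.Ring
open import Algebra.Solver.Ring.AlmostCommutativeRing using (_-Raw-AlmostCommutative⟶_; fromCommutativeRing)
import Data.Integer as ℤ
import Data.Integer.Properties as ℤ
open import Data.List using (List; []; _∷_; map; length; foldr; applyUpTo)
import Data.Maybe as Maybe
import Data.Nat as ℕ
open import Data.Nat using (ℕ; zero; suc; z≤n; s≤s)
open import Data.Nat.Combinatorics using (_C_; nC1≡n; nCk+nC[k+1]≡[n+1]C[k+1]; k>n⇒nCk≡0)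
import Data.Nat.Properties as ℕ
open import Data.Product using (Σ-syntax; ∃; ∃!; _×_; _,_; proj₁; proj₂)
open import Data.Rational using (ℚ; 0ℚ; -_)
open import Defs
open import Function using (_∘_)
open import Relation.Binary.Consequences using (dec⇒weaklyDec)
open import Relation.Binary.PropositionalEquality
open import Relation.Nullary using (contradiction)

module _ where
  open import Data.Rational using (1ℚ; _+_; _*_; _-_; 1/_; ≢-nonZero; toℚᵘ; fromℚᵘ)
  open import Data.Rational.Properties
  import Data.Rational.Unnormalised as ℚᵘ
  import Data.Rational.Unnormalised.Properties as ℚᵘ

  fromℤ-+ : ∀ i j → fromℤ (i ℤ.+ j) ≡ fromℤ i + fromℤ j
  fromℤ-+ i j = toℚᵘ-injective (begin
    toℚᵘ (fromℤ (i ℤ.+ j))               ≈⟨ toℚᵘ-fromℚᵘ (ℚᵘ.mkℚᵘ (i ℤ.+ j) 0) ⟩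
    ℚᵘ.mkℚᵘ (i ℤ.+ j) 0                   ≈⟨ ℚᵘ.*≡* (cong (ℤ._* ℤ.+ 1)
                                            (sym (cong₂ ℤ._+_ (ℤ.*-identityʳ i) (ℤ.*-identityʳ j)))) ⟩
    ℚᵘ.mkℚᵘ i 0 ℚᵘ.+ ℚᵘ.mkℚᵘ j 0          ≈⟨ ℚᵘ.+-cong (toℚᵘ-fromℚᵘ (ℚᵘ.mkℚᵘ i 0))
                                                      (toℚᵘ-fromℚᵘ (ℚᵘ.mkℚᵘ j 0)) ⟨
    toℚᵘ (fromℤ i) ℚᵘ.+ toℚᵘ (fromℤ j)    ≈⟨ toℚᵘ-homo-+ (fromℤ i) (fromℤ j) ⟨
    toℚᵘ (fromℤ i + fromℤ j)             ∎)
    where open ℚᵘ.≃-Reasoning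

  fromℤ-* : ∀ i j → fromℤ (i ℤ.* j) ≡ fromℤ i * fromℤ j
  fromℤ-* i j = toℚᵘ-injective (begin
    toℚᵘ (fromℤ (i ℤ.* j))               ≈⟨ toℚᵘ-fromℚᵘ (ℚᵘ.mkℚᵘ (i ℤ.* j) 0) ⟩
    ℚᵘ.mkℚᵘ i 0 ℚᵘ.* ℚᵘ.mkℚᵘ j 0          ≈⟨ ℚᵘ.*-cong (toℚᵘ-fromℚᵘ (ℚᵘ.mkℚᵘ i 0))
                                                      (toℚᵘ-fromℚᵘ (ℚᵘ.mkℚᵘ j 0)) ⟨
    toℚᵘ (fromℤ i) ℚᵘ.* toℚᵘ (fromℤ j)    ≈⟨ toℚᵘ-homo-* (fromℤ i) (fromℤ j) ⟨
    toℚᵘ (fromℤ i * fromℤ j)             ∎)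
    where open ℚᵘ.≃-Reasoning

  fromℤ-neg : ∀ i → fromℤ (ℤ.- i) ≡ - fromℤ i
  fromℤ-neg i = begin
    fromℤ (ℤ.- i)         ≡⟨ cong fromℤ (ℤ.-1*i≡-i i) ⟨
    fromℤ (ℤ.-1ℤ ℤ.* i)   ≡⟨ fromℤ-* ℤ.-1ℤ i ⟩
    - 1ℚ * fromℤ i        ≡⟨ neg-distribˡ-* 1ℚ (fromℤ i) ⟨
    - (1ℚ * fromℤ i)      ≡⟨ cong -_ (*-identityˡ (fromℤ i)) ⟩
    - fromℤ i             ∎
    where open ≡-Reasoning

  fromℕ-+ : ∀ m n → fromℕ (m ℕ.+ n) ≡ fromℕ m + fromℕ n
  fromℕ-+ m n = fromℤ-+ (ℤ.+ m) (ℤ.+ n)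

  fromℕ-* : ∀ m n → fromℕ (m ℕ.* n) ≡ fromℕ m * fromℕ n
  fromℕ-* m n = trans (cong fromℤ (ℤ.pos-* m n)) (fromℤ-* (ℤ.+ m) (ℤ.+ n))

  fromℕ-suc : ∀ n → fromℕ (suc n) ≡ fromℕ n + 1ℚ
  fromℕ-suc n = trans (fromℕ-+ 1 n) (+-comm 1ℚ (fromℕ n))

  fromℕ-injective : ∀ {m n} → fromℕ m ≡ fromℕ n → m ≡ n
  fromℕ-injective {m} {n} eq = ℤ.+-injective (ℤ.*-cancelʳ-≡ _ _ (ℤ.+ 1) (ℚᵘ.drop-*≡* (begin
    ℚᵘ.mkℚᵘ (ℤ.+ m) 0  ≈⟨ toℚᵘ-fromℚᵘ (ℚᵘ.mkℚᵘ (ℤ.+ m) 0) ⟨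
    toℚᵘ (fromℕ m)     ≡⟨ cong toℚᵘ eq ⟩
    toℚᵘ (fromℕ n)     ≈⟨ toℚᵘ-fromℚᵘ (ℚᵘ.mkℚᵘ (ℤ.+ n) 0) ⟩
    ℚᵘ.mkℚᵘ (ℤ.+ n) 0  ∎)))
    where open ℚᵘ.≃-Reasoning

  C-absorption : ∀ n k → suc k ℕ.* (suc n C suc k) ≡ suc n ℕ.* (n C k)
  C-absorption zero    zero    = refl
  C-absorption zero    (suc k) = ℕ.*-zeroʳ (suc (suc k))
  C-absorption (suc n) zero    = trans (cong (ℕ._+ 0) (nC1≡n (suc (suc n)))) (ℕ.*-comm 1 (suc (suc n)))
  C-absorption (suc n) (suc k) = begin
    suc (suc k) ℕ.* (suc (suc n) C suc (suc k))
      ≡⟨ cong (suc (suc k) ℕ.*_) (nCk+nC[k+1]≡[n+1]C[k+1] (suc n) (suc k)) ⟨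
    suc (suc k) ℕ.* (suc n C suc k ℕ.+ suc n C suc (suc k))
      ≡⟨ ℕ.*-distribˡ-+ (suc (suc k)) (suc n C suc k) (suc n C suc (suc k)) ⟩
    (suc n C suc k ℕ.+ suc k ℕ.* (suc n C suc k)) ℕ.+ suc (suc k) ℕ.* (suc n C suc (suc k))
      ≡⟨ cong₂ (λ u v → (suc n C suc k ℕ.+ u) ℕ.+ v) (C-absorption n k) (C-absorption n (suc k)) ⟩
    (suc n C suc k ℕ.+ suc n ℕ.* (n C k)) ℕ.+ suc n ℕ.* (n C suc k)
      ≡⟨ ℕ.+-assoc (suc n C suc k) (suc n ℕ.* (n C k)) (suc n ℕ.* (n C suc k)) ⟩
    suc n C suc k ℕ.+ (suc n ℕ.* (n C k) ℕ.+ suc n ℕ.* (n C suc k))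
      ≡⟨ cong (suc n C suc k ℕ.+_) (ℕ.*-distribˡ-+ (suc n) (n C k) (n C suc k)) ⟨
    suc n C suc k ℕ.+ suc n ℕ.* (n C k ℕ.+ n C suc k)
      ≡⟨ cong (λ u → suc n C suc k ℕ.+ suc n ℕ.* u) (nCk+nC[k+1]≡[n+1]C[k+1] n k) ⟩
    suc (suc n) ℕ.* (suc n C suc k) ∎
    where open ≡-Reasoning

  ℤ⟶ℚ : ℤ.+-*-rawRing -Raw-AlmostCommutative⟶ fromCommutativeRing +-*-commutativeRing
  ℤ⟶ℚ = record
    { ⟦_⟧    = fromℤ
    ; +-homo = fromℤ-+
    ; *-homo = fromℤ-*
    ; -‿homo = fromℤ-neg
    ; 0-homo = refl
    ; 1-homo = refl
    }

  -- With coefficients in ℤ rather than ℚ, normalisation never reduces fractions.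
  module RingSolver = Algebra.Solver.Ring ℤ.+-*-rawRing (fromCommutativeRing +-*-commutativeRing) ℤ⟶ℚ
    (λ i j → Maybe.map (cong fromℤ) (dec⇒weaklyDec ℤ._≟_ i j))
  open RingSolver using (Polynomial; con; solve; _:=_; _:+_; _:*_; _:-_; :-_)

  𝟘 𝟙 : ∀ {n} → Polynomial n
  𝟘 = con (ℤ.+ 0)
  𝟙 = con (ℤ.+ 1)

  lincomb : ∀ {p q x y} c → x ≡ y → p - q ≡ c * (x - y) → p ≡ q
  lincomb {p} {q} {x} c refl eq = begin
    p            ≡⟨ solve 2 (λ p q → p := (p :- q) :+ q) refl p q ⟩
    (p - q) + q  ≡⟨ cong (_+ q) eq ⟩
    c * (x - x) + q ≡⟨ solve 3 (λ c x q → c :* (x :- x) :+ q := q) refl c x q ⟩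
    q            ∎
    where open ≡-Reasoning

  *-cancelˡ-≢0 : ∀ {c p q} → c ≢ 0ℚ → c * p ≡ c * q → p ≡ q
  *-cancelˡ-≢0 {c} {p} {q} c≢0 eq = begin
    p               ≡⟨ undo p ⟨
    1/ c * (c * p)  ≡⟨ cong (1/ c *_) eq ⟩
    1/ c * (c * q)  ≡⟨ undo q ⟩
    q               ∎
    where
    open ≡-Reasoning
    instance _ = ≢-nonZero c≢0
    undo : ∀ x → 1/ c * (c * x) ≡ x
    undo x = trans (sym (*-assoc (1/ c) c x)) (trans (cong (_* x) (*-inverseˡ c)) (*-identityˡ x))

  *-≢0 : ∀ {p q} → p ≢ 0ℚ → q ≢ 0ℚ → p * q ≢ 0ℚ
  *-≢0 {p} p≢0 q≢0 eq = q≢0 (*-cancelˡ-≢0 p≢0 (trans eq (sym (*-zeroʳ p))))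

  binom : ℕ → ℕ → ℚ
  binom n k = fromℕ (n C k)

  binom-pascal : ∀ n k → binom (suc n) (suc k) ≡ binom n k + binom n (suc k)
  binom-pascal n k = trans (cong fromℕ (sym (nCk+nC[k+1]≡[n+1]C[k+1] n k))) (fromℕ-+ (n C k) (n C suc k))

  binom-absorption : ∀ n k →
    (fromℕ k + 1ℚ) * binom (suc n) (suc k) ≡ (fromℕ n + 1ℚ) * binom n k
  binom-absorption n k = begin
    (fromℕ k + 1ℚ) * binom (suc n) (suc k)  ≡⟨ cong (_* binom (suc n) (suc k)) (fromℕ-suc k) ⟨
    fromℕ (suc k) * binom (suc n) (suc k)   ≡⟨ fromℕ-* (suc k) (suc n C suc k) ⟨
    fromℕ (suc k ℕ.* (suc n C suc k))       ≡⟨ cong fromℕ (C-absorption n k) ⟩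
    fromℕ (suc n ℕ.* (n C k))               ≡⟨ fromℕ-* (suc n) (n C k) ⟩
    fromℕ (suc n) * binom n k               ≡⟨ cong (_* binom n k) (fromℕ-suc n) ⟩
    (fromℕ n + 1ℚ) * binom n k              ∎
    where open ≡-Reasoning

  binom-sucʳ : ∀ n k →
    (fromℕ k + 1ℚ) * binom n (suc k) ≡ (fromℕ n - fromℕ k) * binom n k
  binom-sucʳ n k = lincomb 1ℚ
    (trans (cong ((fromℕ k + 1ℚ) *_) (sym (binom-pascal n k))) (binom-absorption n k))
    (solve 4 (λ n k x y →
        (k :+ 𝟙) :* y :- (n :- k) :* x
      := 𝟙 :* ((k :+ 𝟙) :* (x :+ y) :- (n :+ 𝟙) :* x))
      refl (fromℕ n) (fromℕ k) (binom n k) (binom n (suc k)))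

  binom-sucˡ : ∀ n k →
    (fromℕ n + 1ℚ - fromℕ k) * binom (suc n) k ≡ (fromℕ n + 1ℚ) * binom n k
  binom-sucˡ n zero    = cong (_* 1ℚ) (solve 1 (λ n → n :+ 𝟙 :- 𝟘 := n :+ 𝟙) refl (fromℕ n))
  binom-sucˡ n (suc k) = begin
    (fromℕ n + 1ℚ - fromℕ (suc k)) * binom (suc n) (suc k)
      ≡⟨ cong₂ (λ u v → (fromℕ n + 1ℚ - u) * v) (fromℕ-suc k) (binom-pascal n k) ⟩
    (fromℕ n + 1ℚ - (fromℕ k + 1ℚ)) * (binom n k + binom n (suc k))
      ≡⟨ lincomb (- 1ℚ) (binom-sucʳ n k)
        (solve 4 (λ n k x y →
            (n :+ 𝟙 :- (k :+ 𝟙)) :* (x :+ y) :- (n :+ 𝟙) :* y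
          := con ℤ.-1ℤ :* ((k :+ 𝟙) :* y :- (n :- k) :* x))
          refl (fromℕ n) (fromℕ k) (binom n k) (binom n (suc k))) ⟩
    (fromℕ n + 1ℚ) * binom n (suc k)  ∎
    where open ≡-Reasoning

  -- Polynomial arithmetic

  merge : {A : Set} → (A → A → A) → List A → List A → List A
  merge f []       ys       = ys
  merge f (x ∷ xs) []       = x ∷ xs
  merge f (x ∷ xs) (y ∷ ys) = f x y ∷ merge f xs ys

  nth-merge : ∀ {A : Set} {f : A → A → A} {d} → (∀ x → f d x ≡ x) → (∀ x → f x d ≡ x) →
    ∀ xs ys n → nth d (merge f xs ys) n ≡ f (nth d xs n) (nth d ys n)
  nth-merge l r []       ys       n       = sym (l _)
  nth-merge l r (x ∷ xs) []       zero    = sym (r x)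
  nth-merge l r (x ∷ xs) []       (suc n) = sym (r _)
  nth-merge l r (x ∷ xs) (y ∷ ys) zero    = refl
  nth-merge l r (x ∷ xs) (y ∷ ys) (suc n) = nth-merge l r xs ys n

  nth-map : ∀ {A B : Set} {f : A → B} {d e} → f d ≡ e →
    ∀ xs n → nth e (map f xs) n ≡ f (nth d xs n)
  nth-map eq []       n       = sym eq
  nth-map eq (x ∷ xs) zero    = refl
  nth-map eq (x ∷ xs) (suc n) = nth-map eq xs n

  infixl 6 _⊞_ _⊞₂_
  infixl 7 _⊡_ _⊡₂_

  _⊞_ : Poly → Poly → Poly
  _⊞_ = merge _+_

  _⊡_ : ℚ → Poly → Poly
  c ⊡ q = map (c *_) q

  _⊞₂_ : Poly₂ → Poly₂ → Poly₂
  _⊞₂_ = merge _⊞_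

  _⊡₂_ : ℚ → Poly₂ → Poly₂
  c ⊡₂ Q = map (c ⊡_) Q

  b·_ : Poly₂ → Poly₂
  b· Q = [] ∷ Q

  j·_ : Poly₂ → Poly₂
  j· Q = map (0ℚ ∷_) Q

  nth-⊞ : ∀ p q n → nth 0ℚ (p ⊞ q) n ≡ nth 0ℚ p n + nth 0ℚ q n
  nth-⊞ = nth-merge +-identityˡ +-identityʳ

  nth-⊡ : ∀ c q n → nth 0ℚ (c ⊡ q) n ≡ c * nth 0ℚ q n
  nth-⊡ c = nth-map (*-zeroʳ c)

  coeff-⊞₂ : ∀ P Q r s → coeff (P ⊞₂ Q) r s ≡ coeff P r s + coeff Q r s
  coeff-⊞₂ P Q r s = trans
    (cong (λ q → nth 0ℚ q s) (nth-merge (λ _ → refl) (λ { [] → refl ; (_ ∷ _) → refl }) P Q r))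
    (nth-⊞ (nth [] P r) (nth [] Q r) s)

  coeff-⊡₂ : ∀ c Q r s → coeff (c ⊡₂ Q) r s ≡ c * coeff Q r s
  coeff-⊡₂ c Q r s = trans (cong (λ q → nth 0ℚ q s) (nth-map refl Q r)) (nth-⊡ c (nth [] Q r) s)

  coeff-j·-zero : ∀ Q r → coeff (j· Q) r 0 ≡ 0ℚ
  coeff-j·-zero []      r       = refl
  coeff-j·-zero (q ∷ Q) zero    = refl
  coeff-j·-zero (q ∷ Q) (suc r) = coeff-j·-zero Q r

  coeff-j·-suc : ∀ Q r s → coeff (j· Q) r (suc s) ≡ coeff Q r s
  coeff-j·-suc []      r       s = refl
  coeff-j·-suc (q ∷ Q) zero    s = refl
  coeff-j·-suc (q ∷ Q) (suc r) s = coeff-j·-suc Q r s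

  eval₁-⊞ : ∀ p q y → eval₁ (p ⊞ q) y ≡ eval₁ p y + eval₁ q y
  eval₁-⊞ []      q       y = sym (+-identityˡ _)
  eval₁-⊞ (c ∷ p) []      y = sym (+-identityʳ _)
  eval₁-⊞ (c ∷ p) (d ∷ q) y = trans (cong (λ v → c + d + y * v) (eval₁-⊞ p q y))
    (solve 5 (λ c d y u v → c :+ d :+ y :* (u :+ v) := (c :+ y :* u) :+ (d :+ y :* v))
      refl c d y (eval₁ p y) (eval₁ q y))

  eval₁-⊡ : ∀ c q y → eval₁ (c ⊡ q) y ≡ c * eval₁ q y
  eval₁-⊡ c []      y = sym (*-zeroʳ c)
  eval₁-⊡ c (d ∷ q) y = trans (cong (λ v → c * d + y * v) (eval₁-⊡ c q y))
    (solve 4 (λ c d y v → c :* d :+ y :* (c :* v) := c :* (d :+ y :* v))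
      refl c d y (eval₁ q y))

  eval-⊞₂ : ∀ P Q x y → eval (P ⊞₂ Q) x y ≡ eval P x y + eval Q x y
  eval-⊞₂ []      Q       x y = sym (+-identityˡ _)
  eval-⊞₂ (p ∷ P) []      x y = sym (+-identityʳ _)
  eval-⊞₂ (p ∷ P) (q ∷ Q) x y = trans (cong₂ (λ u v → u + x * v) (eval₁-⊞ p q y) (eval-⊞₂ P Q x y))
    (solve 5 (λ c d y u v → c :+ d :+ y :* (u :+ v) := (c :+ y :* u) :+ (d :+ y :* v))
      refl (eval₁ p y) (eval₁ q y) x (eval P x y) (eval Q x y))

  eval-⊡₂ : ∀ c Q x y → eval (c ⊡₂ Q) x y ≡ c * eval Q x y
  eval-⊡₂ c []      x y = sym (*-zeroʳ c)
  eval-⊡₂ c (q ∷ Q) x y = trans (cong₂ (λ u v → u + x * v) (eval₁-⊡ c q y) (eval-⊡₂ c Q x y))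
    (solve 4 (λ c d y v → c :* d :+ y :* (c :* v) := c :* (d :+ y :* v))
      refl c (eval₁ q y) x (eval Q x y))

  eval-b· : ∀ Q x y → eval (b· Q) x y ≡ x * eval Q x y
  eval-b· Q x y = +-identityˡ _

  eval-j· : ∀ Q x y → eval (j· Q) x y ≡ y * eval Q x y
  eval-j· []      x y = sym (*-zeroʳ y)
  eval-j· (q ∷ Q) x y = trans (cong (λ v → 0ℚ + y * eval₁ q y + x * v) (eval-j· Q x y))
    (solve 4 (λ y u x v → 𝟘 :+ y :* u :+ x :* (y :* v) := y :* (u :+ x :* v))
      refl y (eval₁ q y) x (eval Q x y))

  -- Synthetic division: c + y q(y) has quotient quot a q on division by y − a.
  quot : ℚ → Poly → Poly
  quot a []      = []
  quot a (d ∷ q) = eval₁ (d ∷ q) a ∷ quot a q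

  length-quot : ∀ a q → length (quot a q) ≡ length q
  length-quot a []      = refl
  length-quot a (d ∷ q) = cong suc (length-quot a q)

  nth-quot-zero : ∀ a q → nth 0ℚ (quot a q) 0 ≡ eval₁ q a
  nth-quot-zero a []      = refl
  nth-quot-zero a (d ∷ q) = refl

  eval₁-quot : ∀ a q y → y * eval₁ q y - a * eval₁ q a ≡ (y - a) * eval₁ (quot a q) y
  eval₁-quot a []      y = solve 2 (λ y a → y :* 𝟘 :- a :* 𝟘 := (y :- a) :* 𝟘) refl y a
  eval₁-quot a (c ∷ q) y = lincomb y (eval₁-quot a q y)
    (solve 6 (λ c y a u v d →
       (y :* (c :+ y :* u) :- a :* (c :+ a :* v)) :- (y :- a) :* (c :+ a :* v :+ y :* d)
       := y :* ((y :* u :- a :* v) :- (y :- a) :* d))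
     refl c y a (eval₁ q y) (eval₁ q a) (eval₁ (quot a q) y))

  constant≡0 : ∀ c a q → eval₁ (c ∷ q) a ≡ 0ℚ → nth 0ℚ (quot a q) 0 ≡ 0ℚ → c ≡ 0ℚ
  constant≡0 c a q root z = begin
    c                  ≡⟨ solve 2 (λ c a → c := c :+ a :* 𝟘) refl c a ⟩
    c + a * 0ℚ         ≡⟨ cong (λ v → c + a * v) (trans (sym (nth-quot-zero a q)) z) ⟨
    c + a * eval₁ q a  ≡⟨ root ⟩
    0ℚ                 ∎
    where open ≡-Reasoning

  quot-zero : ∀ a q → (∀ n → nth 0ℚ (quot a q) n ≡ 0ℚ) → ∀ n → nth 0ℚ q n ≡ 0ℚ
  quot-zero a []      _ n       = refl
  quot-zero a (c ∷ q) z zero    = constant≡0 c a q (z 0) (z 1)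
  quot-zero a (c ∷ q) z (suc n) = quot-zero a q (z ∘ suc) n

  eventually-zero : ∀ q N → (∀ n → N ℕ.< n → eval₁ q (fromℕ n) ≡ 0ℚ) → ∀ s → nth 0ℚ q s ≡ 0ℚ
  eventually-zero q = go (length q) q refl
    where
    go : ∀ l q → length q ≡ l → ∀ N → (∀ n → N ℕ.< n → eval₁ q (fromℕ n) ≡ 0ℚ) →
      ∀ s → nth 0ℚ q s ≡ 0ℚ
    go l       []      _   _ _      s = refl
    go (suc l) (c ∷ q) len N vanish = λ
      { zero    → constant≡0 c a q root (quot≈0 0)
      ; (suc n) → quot-zero a q quot≈0 n }
      where
      open ≡-Reasoning
      a = fromℕ (suc N)
      root = vanish (suc N) ℕ.≤-refl
      n≢a : ∀ {n} → suc N ℕ.< n → fromℕ n - a ≢ 0ℚ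
      n≢a {n} N<n eq = ℕ.<-irrefl (sym (fromℕ-injective (lincomb 1ℚ eq
        (solve 2 (λ n a → n :- a := 𝟙 :* (n :- a :- 𝟘)) refl (fromℕ n) a)))) N<n
      quot≈0 = go l (quot a q) (trans (length-quot a q) (ℕ.suc-injective len)) (suc N) λ n N<n →
        *-cancelˡ-≢0 (n≢a N<n) (begin
          (fromℕ n - a) * eval₁ (quot a q) (fromℕ n)
            ≡⟨ eval₁-quot a q (fromℕ n) ⟨
          fromℕ n * eval₁ q (fromℕ n) - a * eval₁ q a
            ≡⟨ solve 3 (λ c u v → u :- v := (c :+ u) :- (c :+ v))
                 refl c (fromℕ n * eval₁ q (fromℕ n)) (a * eval₁ q a) ⟩
          eval₁ (c ∷ q) (fromℕ n) - eval₁ (c ∷ q) a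
            ≡⟨ cong₂ _-_ (vanish n (ℕ.<-trans (ℕ.n<1+n _) N<n)) root ⟩
          0ℚ
            ≡⟨ *-zeroʳ (fromℕ n - a) ⟨
          (fromℕ n - a) * 0ℚ  ∎)

  column : ℕ → Poly₂ → Poly
  column s = map (λ q → nth 0ℚ q s)

  atb : Poly₂ → ℚ → Poly
  atb Q x = foldr (λ q v → q ⊞ x ⊡ v) [] Q

  eval₁-atb : ∀ Q x y → eval₁ (atb Q x) y ≡ eval Q x y
  eval₁-atb []      x y = refl
  eval₁-atb (q ∷ Q) x y = begin
    eval₁ (q ⊞ x ⊡ atb Q x) y           ≡⟨ eval₁-⊞ q (x ⊡ atb Q x) y ⟩
    eval₁ q y + eval₁ (x ⊡ atb Q x) y   ≡⟨ cong (eval₁ q y +_) (eval₁-⊡ x (atb Q x) y) ⟩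
    eval₁ q y + x * eval₁ (atb Q x) y   ≡⟨ cong (λ v → eval₁ q y + x * v) (eval₁-atb Q x y) ⟩
    eval₁ q y + x * eval Q x y          ∎
    where open ≡-Reasoning

  nth-atb : ∀ Q x s → nth 0ℚ (atb Q x) s ≡ eval₁ (column s Q) x
  nth-atb []      x s = refl
  nth-atb (q ∷ Q) x s = begin
    nth 0ℚ (q ⊞ x ⊡ atb Q x) s                ≡⟨ nth-⊞ q (x ⊡ atb Q x) s ⟩
    nth 0ℚ q s + nth 0ℚ (x ⊡ atb Q x) s       ≡⟨ cong (nth 0ℚ q s +_) (nth-⊡ x (atb Q x) s) ⟩
    nth 0ℚ q s + x * nth 0ℚ (atb Q x) s       ≡⟨ cong (λ v → nth 0ℚ q s + x * v) (nth-atb Q x s) ⟩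
    nth 0ℚ q s + x * eval₁ (column s Q) x     ∎
    where open ≡-Reasoning

  eventually-zero₂ : ∀ Q → (∀ b j → b ℕ.< j → eval Q (fromℕ b) (fromℕ j) ≡ 0ℚ) →
    ∀ r s → coeff Q r s ≡ 0ℚ
  eventually-zero₂ Q vanish r s = trans (sym (nth-map refl Q r))
    (eventually-zero (column s Q) 0 (λ b _ → trans (sym (nth-atb Q (fromℕ b) s))
      (eventually-zero (atb Q (fromℕ b)) b
        (λ j b<j → trans (eval₁-atb Q (fromℕ b) (fromℕ j)) (vanish b j b<j)) s)) r)

  eventually-equal : ∀ P Q →
    (∀ b j → b ℕ.< j → eval P (fromℕ b) (fromℕ j) ≡ eval Q (fromℕ b) (fromℕ j)) → P ≈ Q
  eventually-equal P Q agree r s = lincomb 1ℚ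
    (trans (sym (coeff-difference r s)) (eventually-zero₂ (P ⊞₂ - 1ℚ ⊡₂ Q) difference≡0 r s))
    (solve 2 (λ p q → p :- q := 𝟙 :* (p :+ con ℤ.-1ℤ :* q :- 𝟘)) refl (coeff P r s) (coeff Q r s))
    where
    coeff-difference : ∀ r s → coeff (P ⊞₂ - 1ℚ ⊡₂ Q) r s ≡ coeff P r s + - 1ℚ * coeff Q r s
    coeff-difference r s = trans (coeff-⊞₂ P (- 1ℚ ⊡₂ Q) r s) (cong (coeff P r s +_) (coeff-⊡₂ (- 1ℚ) Q r s))
    difference≡0 : ∀ b j → b ℕ.< j → eval (P ⊞₂ - 1ℚ ⊡₂ Q) (fromℕ b) (fromℕ j) ≡ 0ℚ
    difference≡0 b j b<j = begin
      eval (P ⊞₂ - 1ℚ ⊡₂ Q) x y          ≡⟨ eval-⊞₂ P (- 1ℚ ⊡₂ Q) x y ⟩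
      eval P x y + eval (- 1ℚ ⊡₂ Q) x y  ≡⟨ cong₂ _+_ (agree b j b<j) (eval-⊡₂ (- 1ℚ) Q x y) ⟩
      eval Q x y + - 1ℚ * eval Q x y     ≡⟨ solve 1 (λ q → q :+ con ℤ.-1ℤ :* q := 𝟘) refl (eval Q x y) ⟩
      0ℚ                                 ∎
      where
      open ≡-Reasoning
      x = fromℕ b
      y = fromℕ j

  -- Solving the recurrence in the Newton basis

  -- ∑ₗ aₗ ∏_{i ≤ m < i+l} (t − m(m+1)).
  newton : ℕ → List ℚ → ℚ → ℚ
  newton i []       t = 0ℚ
  newton i (a ∷ as) t = a + (t - fromℕ i * (fromℕ i + 1ℚ)) * newton (suc i) as t

  remainder : ℕ → List ℚ → Poly
  remainder i []       = []
  remainder i (a ∷ as) = (a ∷ []) ⊞ m ⊡ (0ℚ ∷ ρ) ⊞ (- (m * m)) ⊡ ρ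
    where
    m = fromℕ i + 1ℚ
    ρ = remainder (suc i) as

  solution : ℕ → List ℚ → Poly₂
  solution i []       = []
  solution i (a ∷ as) = (remainder i (a ∷ as) ∷ []) ⊞₂ b· b· σ ⊞₂ (- (fromℕ i * fromℕ i)) ⊡₂ σ
    where
    σ = solution (suc i) as

  eval-remainder : ∀ i a as y → let m = fromℕ i + 1ℚ in
    eval₁ (remainder i (a ∷ as)) y ≡ a + m * (y - m) * eval₁ (remainder (suc i) as) y
  eval-remainder i a as y = begin
    eval₁ ((a ∷ []) ⊞ m ⊡ (0ℚ ∷ ρ) ⊞ (- (m * m)) ⊡ ρ) y
      ≡⟨ eval₁-⊞ ((a ∷ []) ⊞ m ⊡ (0ℚ ∷ ρ)) ((- (m * m)) ⊡ ρ) y ⟩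
    eval₁ ((a ∷ []) ⊞ m ⊡ (0ℚ ∷ ρ)) y + eval₁ ((- (m * m)) ⊡ ρ) y
      ≡⟨ cong₂ _+_ (trans (eval₁-⊞ (a ∷ []) (m ⊡ (0ℚ ∷ ρ)) y)
                          (cong (a + y * 0ℚ +_) (eval₁-⊡ m (0ℚ ∷ ρ) y)))
                   (eval₁-⊡ (- (m * m)) ρ y) ⟩
    a + y * 0ℚ + m * (0ℚ + y * eval₁ ρ y) + - (m * m) * eval₁ ρ y
      ≡⟨ solve 4 (λ a y m v → a :+ y :* 𝟘 :+ m :* (𝟘 :+ y :* v) :+ :- (m :* m) :* v
                 := a :+ m :* (y :- m) :* v) refl a y m (eval₁ ρ y) ⟩
    a + m * (y - m) * eval₁ ρ y ∎
    where
    open ≡-Reasoning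
    m = fromℕ i + 1ℚ
    ρ = remainder (suc i) as

  eval-solution : ∀ i a as x y → eval (solution i (a ∷ as)) x y ≡
    eval₁ (remainder i (a ∷ as)) y + (x * x - fromℕ i * fromℕ i) * eval (solution (suc i) as) x y
  eval-solution i a as x y = begin
    eval ((ρ ∷ []) ⊞₂ b· b· σ ⊞₂ (- (n * n)) ⊡₂ σ) x y
      ≡⟨ eval-⊞₂ ((ρ ∷ []) ⊞₂ b· b· σ) ((- (n * n)) ⊡₂ σ) x y ⟩
    eval ((ρ ∷ []) ⊞₂ b· b· σ) x y + eval ((- (n * n)) ⊡₂ σ) x y
      ≡⟨ cong₂ _+_ (eval-⊞₂ (ρ ∷ []) (b· b· σ) x y) (eval-⊡₂ (- (n * n)) σ x y) ⟩
    eval₁ ρ y + x * 0ℚ + (0ℚ + x * (0ℚ + x * eval σ x y)) + - (n * n) * eval σ x y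
      ≡⟨ solve 4 (λ u x n v → u :+ x :* 𝟘 :+ (𝟘 :+ x :* (𝟘 :+ x :* v)) :+ :- (n :* n) :* v
                 := u :+ (x :* x :- n :* n) :* v) refl (eval₁ ρ y) x n (eval σ x y) ⟩
    eval₁ ρ y + (x * x - n * n) * eval σ x y ∎
    where
    open ≡-Reasoning
    n = fromℕ i
    ρ = remainder i (a ∷ as)
    σ = solution (suc i) as

  -- The recurrence below, applied to ∏_{m<i} (b² − m²) · solution i as and with the
  -- common factor of the two terms divided out.
  solution-step : ∀ i as x y → let n = fromℕ i; σ = solution i as in
    (y + x) * x * (x - n + 1ℚ) * eval σ x y
      + (x + 1ℚ - y) * (x + 1ℚ) * (x + n) * eval σ (x + 1ℚ) y
    ≡ (x + x + 1ℚ) * ((x + n) * (x - n + 1ℚ) * newton i as (x * x + x)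
                      + n * (n - y) * eval₁ (remainder i as) y)
  solution-step i [] x y =
    solve 3 (λ x y n →
      (y :+ x) :* x :* (x :- n :+ 𝟙) :* 𝟘 :+ (x :+ 𝟙 :- y) :* (x :+ 𝟙) :* (x :+ n) :* 𝟘
      := (x :+ x :+ 𝟙) :* ((x :+ n) :* (x :- n :+ 𝟙) :* 𝟘 :+ n :* (n :- y) :* 𝟘))
      refl x y (fromℕ i)
  solution-step i (a ∷ as) x y = begin
    (y + x) * x * (x - n + 1ℚ) * eval σ x y + (x + 1ℚ - y) * (x + 1ℚ) * (x + n) * eval σ (x + 1ℚ) y
      ≡⟨ cong₂ (λ u v → (y + x) * x * (x - n + 1ℚ) * u + (x + 1ℚ - y) * (x + 1ℚ) * (x + n) * v)
           (eval-solution i a as x y) (eval-solution i a as (x + 1ℚ) y) ⟩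
    (y + x) * x * (x - n + 1ℚ) * (ρ + (x * x - n * n) * s₀)
      + (x + 1ℚ - y) * (x + 1ℚ) * (x + n) * (ρ + ((x + 1ℚ) * (x + 1ℚ) - n * n) * s₁)
      ≡⟨ lincomb ((x + n) * (x - n + 1ℚ)) ih
        (solve 8 (λ x y n ρ ρ′ s₀ s₁ v →
          ((y :+ x) :* x :* (x :- n :+ 𝟙) :* (ρ :+ (x :* x :- n :* n) :* s₀)
            :+ (x :+ 𝟙 :- y) :* (x :+ 𝟙) :* (x :+ n) :* (ρ :+ ((x :+ 𝟙) :* (x :+ 𝟙) :- n :* n) :* s₁))
          :- (x :+ x :+ 𝟙) :* ((x :+ n) :* (x :- n :+ 𝟙) :*
             ((ρ :- (n :+ 𝟙) :* (y :- (n :+ 𝟙)) :* ρ′)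
              :+ (x :* x :+ x :- n :* (n :+ 𝟙)) :* v) :+ n :* (n :- y) :* ρ)
          := (x :+ n) :* (x :- n :+ 𝟙) :*
             (((y :+ x) :* x :* (x :- (n :+ 𝟙) :+ 𝟙) :* s₀
              :+ (x :+ 𝟙 :- y) :* (x :+ 𝟙) :* (x :+ (n :+ 𝟙)) :* s₁)
             :- (x :+ x :+ 𝟙) :* ((x :+ (n :+ 𝟙)) :* (x :- (n :+ 𝟙) :+ 𝟙) :* v
                :+ (n :+ 𝟙) :* ((n :+ 𝟙) :- y) :* ρ′)))
          refl x y n ρ ρ′ s₀ s₁ v) ⟩
    (x + x + 1ℚ) * ((x + n) * (x - n + 1ℚ) *
      ((ρ - (n + 1ℚ) * (y - (n + 1ℚ)) * ρ′) + (x * x + x - n * (n + 1ℚ)) * v) + n * (n - y) * ρ)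
      ≡⟨ cong (λ a → (x + x + 1ℚ) *
             ((x + n) * (x - n + 1ℚ) * (a + (x * x + x - n * (n + 1ℚ)) * v) + n * (n - y) * ρ))
           (trans (cong (_- (n + 1ℚ) * (y - (n + 1ℚ)) * ρ′) (eval-remainder i a as y))
                  (solve 2 (λ a u → a :+ u :- u := a) refl a ((n + 1ℚ) * (y - (n + 1ℚ)) * ρ′))) ⟩
    (x + x + 1ℚ) * ((x + n) * (x - n + 1ℚ) * (a + (x * x + x - n * (n + 1ℚ)) * v) + n * (n - y) * ρ) ∎
    where
    open ≡-Reasoning
    n = fromℕ i
    σ = solution i (a ∷ as)
    ρ = eval₁ (remainder i (a ∷ as)) y
    ρ′ = eval₁ (remainder (suc i) as) y
    s₀ = eval (solution (suc i) as) x y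
    s₁ = eval (solution (suc i) as) (x + 1ℚ) y
    v = newton (suc i) as (x * x + x)
    ih = subst (λ m →
      (y + x) * x * (x - m + 1ℚ) * s₀ + (x + 1ℚ - y) * (x + 1ℚ) * (x + m) * s₁
      ≡ (x + x + 1ℚ) * ((x + m) * (x - m + 1ℚ) * v + m * (m - y) * ρ′))
      (fromℕ-suc i) (solution-step (suc i) as x y)

  solution-recurrence : ∀ as x y → let M = solution 0 as in
    (y + x) * eval M x y + (x + 1ℚ - y) * eval M (x + 1ℚ) y
    ≡ (x + x + 1ℚ) * newton 0 as (x * x + x)
  solution-recurrence [] x y =
    solve 2 (λ x y → (y :+ x) :* 𝟘 :+ (x :+ 𝟙 :- y) :* 𝟘 := (x :+ x :+ 𝟙) :* 𝟘) refl x y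
  solution-recurrence (a ∷ as) x y = begin
    (y + x) * eval M x y + (x + 1ℚ - y) * eval M (x + 1ℚ) y
      ≡⟨ cong₂ (λ u v → (y + x) * u + (x + 1ℚ - y) * v)
           (eval-solution 0 a as x y) (eval-solution 0 a as (x + 1ℚ) y) ⟩
    (y + x) * (ρ + (x * x - 0ℚ * 0ℚ) * s₀)
      + (x + 1ℚ - y) * (ρ + ((x + 1ℚ) * (x + 1ℚ) - 0ℚ * 0ℚ) * s₁)
      ≡⟨ cong (λ ρ → (y + x) * (ρ + (x * x - 0ℚ * 0ℚ) * s₀)
           + (x + 1ℚ - y) * (ρ + ((x + 1ℚ) * (x + 1ℚ) - 0ℚ * 0ℚ) * s₁)) (eval-remainder 0 a as y) ⟩
    (y + x) * (a + (0ℚ + 1ℚ) * (y - (0ℚ + 1ℚ)) * ρ′ + (x * x - 0ℚ * 0ℚ) * s₀)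
      + (x + 1ℚ - y) * (a + (0ℚ + 1ℚ) * (y - (0ℚ + 1ℚ)) * ρ′ + ((x + 1ℚ) * (x + 1ℚ) - 0ℚ * 0ℚ) * s₁)
      ≡⟨ lincomb 1ℚ (solution-step 1 as x y)
        (solve 7 (λ x y a ρ′ s₀ s₁ v →
          ((y :+ x) :* (a :+ (𝟘 :+ 𝟙) :* (y :- (𝟘 :+ 𝟙)) :* ρ′ :+ (x :* x :- 𝟘 :* 𝟘) :* s₀)
            :+ (x :+ 𝟙 :- y) :* (a :+ (𝟘 :+ 𝟙) :* (y :- (𝟘 :+ 𝟙)) :* ρ′
              :+ ((x :+ 𝟙) :* (x :+ 𝟙) :- 𝟘 :* 𝟘) :* s₁))
          :- (x :+ x :+ 𝟙) :* (a :+ (x :* x :+ x :- 𝟘 :* (𝟘 :+ 𝟙)) :* v)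
          := 𝟙 :* (((y :+ x) :* x :* (x :- 𝟙 :+ 𝟙) :* s₀ :+ (x :+ 𝟙 :- y) :* (x :+ 𝟙) :* (x :+ 𝟙) :* s₁)
             :- (x :+ x :+ 𝟙) :* ((x :+ 𝟙) :* (x :- 𝟙 :+ 𝟙) :* v :+ 𝟙 :* (𝟙 :- y) :* ρ′)))
          refl x y a ρ′ s₀ s₁ v) ⟩
    (x + x + 1ℚ) * (a + (x * x + x - 0ℚ * (0ℚ + 1ℚ)) * v) ∎
    where
    open ≡-Reasoning
    M = solution 0 (a ∷ as)
    ρ = eval₁ (remainder 0 (a ∷ as)) y
    ρ′ = eval₁ (remainder 1 as) y
    s₀ = eval (solution 1 as) x y
    s₁ = eval (solution 1 as) (x + 1ℚ) y
    v = newton 1 as (x * x + x)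

  nth-remainder : ∀ i a as s → let m = fromℕ i + 1ℚ; ρ = remainder (suc i) as in
    nth 0ℚ (remainder i (a ∷ as)) s
    ≡ nth 0ℚ (a ∷ []) s + m * nth 0ℚ (0ℚ ∷ ρ) s + - (m * m) * nth 0ℚ ρ s
  nth-remainder i a as s = begin
    nth 0ℚ ((a ∷ []) ⊞ m ⊡ (0ℚ ∷ ρ) ⊞ (- (m * m)) ⊡ ρ) s
      ≡⟨ nth-⊞ ((a ∷ []) ⊞ m ⊡ (0ℚ ∷ ρ)) ((- (m * m)) ⊡ ρ) s ⟩
    nth 0ℚ ((a ∷ []) ⊞ m ⊡ (0ℚ ∷ ρ)) s + nth 0ℚ ((- (m * m)) ⊡ ρ) s
      ≡⟨ cong₂ _+_ (trans (nth-⊞ (a ∷ []) (m ⊡ (0ℚ ∷ ρ)) s)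
                          (cong (nth 0ℚ (a ∷ []) s +_) (nth-⊡ m (0ℚ ∷ ρ) s)))
                   (nth-⊡ (- (m * m)) ρ s) ⟩
    nth 0ℚ (a ∷ []) s + m * nth 0ℚ (0ℚ ∷ ρ) s + - (m * m) * nth 0ℚ ρ s ∎
    where
    open ≡-Reasoning
    m = fromℕ i + 1ℚ
    ρ = remainder (suc i) as

  vanishing-combination : ∀ {u v w} c d → u ≡ 0ℚ → v ≡ 0ℚ → w ≡ 0ℚ → u + c * v + d * w ≡ 0ℚ
  vanishing-combination c d refl refl refl = solve 2 (λ c d → 𝟘 :+ c :* 𝟘 :+ d :* 𝟘 := 𝟘) refl c d

  remainder-degree : ∀ i as s → length as ℕ.≤ s → nth 0ℚ (remainder i as) s ≡ 0ℚ
  remainder-degree i []       s       _         = refl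
  remainder-degree i (a ∷ as) (suc s) (s≤s n≤s) = trans (nth-remainder i a as (suc s))
    (vanishing-combination m (- (m * m)) refl (remainder-degree (suc i) as s n≤s)
      (remainder-degree (suc i) as (suc s) (ℕ.m≤n⇒m≤1+n n≤s)))
    where m = fromℕ i + 1ℚ

  remainder-leading : ∀ i as q → length as ≡ suc q → nth 0ℚ as q ≢ 0ℚ →
    nth 0ℚ (remainder i as) q ≢ 0ℚ
  remainder-leading i (a ∷ []) zero _ a≢0 eq = a≢0 (trans
    (solve 2 (λ a m → a := a :+ m :* 𝟘 :+ :- (m :* m) :* 𝟘) refl a (fromℕ i + 1ℚ))
    (trans (sym (nth-remainder i a [] 0)) eq))
  remainder-leading i (a ∷ as@(_ ∷ _)) (suc q) len nz eq =
    *-≢0 m≢0 (remainder-leading (suc i) as q len′ nz) (begin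
      m * nth 0ℚ ρ q
        ≡⟨ solve 2 (λ m v → m :* v := 𝟘 :+ m :* v :+ :- (m :* m) :* 𝟘) refl m (nth 0ℚ ρ q) ⟩
      0ℚ + m * nth 0ℚ ρ q + - (m * m) * 0ℚ
        ≡⟨ cong (λ u → 0ℚ + m * nth 0ℚ ρ q + - (m * m) * u)
             (remainder-degree (suc i) as (suc q) (ℕ.≤-reflexive len′)) ⟨
      0ℚ + m * nth 0ℚ ρ q + - (m * m) * nth 0ℚ ρ (suc q)
        ≡⟨ nth-remainder i a as (suc q) ⟨
      nth 0ℚ (remainder i (a ∷ as)) (suc q)
        ≡⟨ eq ⟩
      0ℚ ∎)
    where
    open ≡-Reasoning
    m = fromℕ i + 1ℚ
    ρ = remainder (suc i) as
    len′ = ℕ.suc-injective len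
    m≢0 : m ≢ 0ℚ
    m≢0 eq = contradiction (fromℕ-injective {suc i} {0} (trans (fromℕ-suc i) eq)) λ ()

  coeff-solution : ∀ i a as r s → let σ = solution (suc i) as in
    coeff (solution i (a ∷ as)) r s
    ≡ coeff (remainder i (a ∷ as) ∷ []) r s + coeff (b· b· σ) r s + - (fromℕ i * fromℕ i) * coeff σ r s
  coeff-solution i a as r s = begin
    coeff ((ρ ∷ []) ⊞₂ b· b· σ ⊞₂ c ⊡₂ σ) r s
      ≡⟨ coeff-⊞₂ ((ρ ∷ []) ⊞₂ b· b· σ) (c ⊡₂ σ) r s ⟩
    coeff ((ρ ∷ []) ⊞₂ b· b· σ) r s + coeff (c ⊡₂ σ) r s
      ≡⟨ cong₂ _+_ (coeff-⊞₂ (ρ ∷ []) (b· b· σ) r s) (coeff-⊡₂ c σ r s) ⟩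
    coeff (ρ ∷ []) r s + coeff (b· b· σ) r s + c * coeff σ r s ∎
    where
    open ≡-Reasoning
    c = - (fromℕ i * fromℕ i)
    ρ = remainder i (a ∷ as)
    σ = solution (suc i) as

  vanishing-sum : ∀ {u v w} c → u ≡ 0ℚ → v ≡ 0ℚ → w ≡ 0ℚ → u + v + c * w ≡ 0ℚ
  vanishing-sum c refl refl refl = solve 1 (λ c → 𝟘 :+ 𝟘 :+ c :* 𝟘 := 𝟘) refl c

  solution-degree-b : ∀ i as r s → length as ℕ.+ length as ℕ.≤ suc r → coeff (solution i as) r s ≡ 0ℚ
  solution-degree-b i []       r s _ = refl
  solution-degree-b i (a ∷ as) r s bound =
    step r (ℕ.≤-trans (ℕ.≤-reflexive (sym (ℕ.+-suc _ _))) (ℕ.≤-pred bound))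
    where
    step : ∀ r → suc (length as ℕ.+ length as) ℕ.≤ r → coeff (solution i (a ∷ as)) r s ≡ 0ℚ
    step (suc zero) (s≤s le) = trans (coeff-solution i a as 1 s)
      (vanishing-sum (- (fromℕ i * fromℕ i)) refl refl (solution-degree-b (suc i) as 1 s (ℕ.≤-trans le z≤n)))
    step (suc (suc r)) (s≤s le) = trans (coeff-solution i a as (suc (suc r)) s)
      (vanishing-sum (- (fromℕ i * fromℕ i)) refl (solution-degree-b (suc i) as r s le)
        (solution-degree-b (suc i) as (suc (suc r)) s (ℕ.m≤n⇒m≤1+n (ℕ.m≤n⇒m≤1+n le))))

  solution-degree-j : ∀ i as r s → length as ℕ.≤ s → coeff (solution i as) r s ≡ 0ℚ
  solution-degree-j i []       r s _ = refl
  solution-degree-j i (a ∷ as) r s n<s = trans (coeff-solution i a as r s)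
    (vanishing-sum (- (fromℕ i * fromℕ i)) (low r) (shifted r) (solution-degree-j (suc i) as r s n≤s))
    where
    n≤s = ℕ.<⇒≤ n<s
    low : ∀ r → coeff (remainder i (a ∷ as) ∷ []) r s ≡ 0ℚ
    low zero    = remainder-degree i (a ∷ as) s n<s
    low (suc r) = refl
    shifted : ∀ r → coeff (b· b· solution (suc i) as) r s ≡ 0ℚ
    shifted zero          = refl
    shifted (suc zero)    = refl
    shifted (suc (suc r)) = solution-degree-j (suc i) as r s n≤s

  solution-leading-b : ∀ i as q → length as ≡ suc q →
    coeff (solution i as) (q ℕ.+ q) 0 ≡ nth 0ℚ as q
  solution-leading-b i (a ∷ []) zero _ = begin
    coeff (solution i (a ∷ [])) 0 0
      ≡⟨ coeff-solution i a [] 0 0 ⟩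
    nth 0ℚ (remainder i (a ∷ [])) 0 + 0ℚ + - (n * n) * 0ℚ
      ≡⟨ cong (λ u → u + 0ℚ + - (n * n) * 0ℚ) (nth-remainder i a [] 0) ⟩
    a + (n + 1ℚ) * 0ℚ + - ((n + 1ℚ) * (n + 1ℚ)) * 0ℚ + 0ℚ + - (n * n) * 0ℚ
      ≡⟨ solve 2 (λ a n → a :+ (n :+ 𝟙) :* 𝟘 :+ :- ((n :+ 𝟙) :* (n :+ 𝟙)) :* 𝟘 :+ 𝟘 :+ :- (n :* n) :* 𝟘 := a)
         refl a n ⟩
    a ∎
    where
    open ≡-Reasoning
    n = fromℕ i
  solution-leading-b i (a ∷ as@(_ ∷ _)) (suc q) len = begin
    coeff (solution i (a ∷ as)) (suc q ℕ.+ suc q) 0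
      ≡⟨ cong (λ r → coeff (solution i (a ∷ as)) (suc r) 0) (ℕ.+-suc q q) ⟩
    coeff (solution i (a ∷ as)) (suc (suc (q ℕ.+ q))) 0
      ≡⟨ coeff-solution i a as (suc (suc (q ℕ.+ q))) 0 ⟩
    0ℚ + coeff σ (q ℕ.+ q) 0 + c * coeff σ (suc (suc (q ℕ.+ q))) 0
      ≡⟨ cong₂ (λ u v → 0ℚ + u + c * v) (solution-leading-b (suc i) as q len′)
           (solution-degree-b (suc i) as _ 0
             (ℕ.m≤n⇒m≤1+n (ℕ.≤-reflexive (trans (cong₂ ℕ._+_ len′ len′) (cong suc (ℕ.+-suc q q)))))) ⟩
    0ℚ + nth 0ℚ as q + c * 0ℚ
      ≡⟨ solve 2 (λ u c → 𝟘 :+ u :+ c :* 𝟘 := u) refl (nth 0ℚ as q) c ⟩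
    nth 0ℚ as q ∎
    where
    open ≡-Reasoning
    c = - (fromℕ i * fromℕ i)
    σ = solution (suc i) as
    len′ = ℕ.suc-injective len

  coeff-solution-0 : ∀ as s → coeff (solution 0 as) 0 s ≡ nth 0ℚ (remainder 0 as) s
  coeff-solution-0 []       s = refl
  coeff-solution-0 (a ∷ as) s = trans (coeff-solution 0 a as 0 s)
    (solve 2 (λ u v → u :+ 𝟘 :+ :- (𝟘 :* 𝟘) :* v := u) refl
      (nth 0ℚ (remainder 0 (a ∷ as)) s) (coeff (solution 1 as) 0 s))

  mul-linear : ℚ → ℚ → ℕ → ℚ → List ℚ → List ℚ
  mul-linear α β i c []       = c ∷ []
  mul-linear α β i c (a ∷ as) =
    (c + (α * (fromℕ i * (fromℕ i + 1ℚ)) + β) * a) ∷ mul-linear α β (suc i) (α * a) as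

  newton-mul-linear : ∀ α β i c as t →
    newton i (mul-linear α β i c as) t ≡ c + (α * t + β) * newton i as t
  newton-mul-linear α β i c []       t =
    solve 5 (λ α β c t ι → c :+ (t :- ι) :* 𝟘 := c :+ (α :* t :+ β) :* 𝟘)
      refl α β c t (fromℕ i * (fromℕ i + 1ℚ))
  newton-mul-linear α β i c (a ∷ as) t = trans
    (cong (λ v → c + (α * ι + β) * a + (t - ι) * v) (newton-mul-linear α β (suc i) (α * a) as t))
    (solve 7 (λ α β c t ι a v → c :+ (α :* ι :+ β) :* a :+ (t :- ι) :* (α :* a :+ (α :* t :+ β) :* v)
       := c :+ (α :* t :+ β) :* (a :+ (t :- ι) :* v)) refl α β c t ι a (newton (suc i) as t))
    where ι = fromℕ i * (fromℕ i + 1ℚ)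

  length-mul-linear : ∀ α β i c as → length (mul-linear α β i c as) ≡ suc (length as)
  length-mul-linear α β i c []       = refl
  length-mul-linear α β i c (a ∷ as) = cong suc (length-mul-linear α β (suc i) (α * a) as)

  mul-linear-leading : ∀ α β i c as q → length as ≡ suc q →
    nth 0ℚ (mul-linear α β i c as) (suc q) ≡ α * nth 0ℚ as q
  mul-linear-leading α β i c (a ∷ [])         zero    _   = refl
  mul-linear-leading α β i c (a ∷ as@(_ ∷ _)) (suc q) len =
    mul-linear-leading α β (suc i) (α * a) as q (ℕ.suc-injective len)

  fromℕ-suc≢0 : ∀ n → fromℕ (suc n) ≢ 0ℚ
  fromℕ-suc≢0 n eq = contradiction (fromℕ-injective {suc n} {0} eq) λ ()

  inverse : ∀ {d} → d ≢ 0ℚ → ∃ λ e → d * e ≡ 1ℚ × e ≢ 0ℚ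
  inverse {d} d≢0 = 1/ d , *-inverseʳ d , λ e≡0 →
    1≢0 (trans (sym (*-inverseʳ d)) (trans (cong (d *_) e≡0) (*-zeroʳ d)))
    where instance _ = ≢-nonZero d≢0

  binom-diagonal : ∀ n r → (fromℕ r + 1ℚ + 1ℚ) * (fromℕ r + 1ℚ) * binom (suc n) (suc (suc r))
    ≡ (fromℕ n + 1ℚ) * (fromℕ n - fromℕ r) * binom n r
  binom-diagonal n r = begin
    (R + 1ℚ) * R * binom (suc n) (suc (suc r))
      ≡⟨ solve 2 (λ R u → (R :+ 𝟙) :* R :* u := R :* ((R :+ 𝟙) :* u)) refl R (binom (suc n) (suc (suc r))) ⟩
    R * ((R + 1ℚ) * binom (suc n) (suc (suc r)))
      ≡⟨ cong (λ u → R * ((u + 1ℚ) * binom (suc n) (suc (suc r)))) (fromℕ-suc r) ⟨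
    R * ((fromℕ (suc r) + 1ℚ) * binom (suc n) (suc (suc r)))
      ≡⟨ cong (R *_) (binom-absorption n (suc r)) ⟩
    R * ((fromℕ n + 1ℚ) * binom n (suc r))
      ≡⟨ solve 3 (λ R n u → R :* (n :* u) := n :* (R :* u)) refl R (fromℕ n + 1ℚ) (binom n (suc r)) ⟩
    (fromℕ n + 1ℚ) * (R * binom n (suc r))
      ≡⟨ cong ((fromℕ n + 1ℚ) *_) (binom-sucʳ n r) ⟩
    (fromℕ n + 1ℚ) * ((fromℕ n - fromℕ r) * binom n r)
      ≡⟨ *-assoc (fromℕ n + 1ℚ) (fromℕ n - fromℕ r) (binom n r) ⟨
    (fromℕ n + 1ℚ) * (fromℕ n - fromℕ r) * binom n r ∎
    where
    open ≡-Reasoning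
    R = fromℕ r + 1ℚ

  weight : ℕ → ℕ → ℚ
  weight p k = binom (2 ℕ.* k ℕ.+ 1 ℕ.+ p) (2 ℕ.* p ℕ.+ 1)

  fromℕ-double+1 : ∀ k → fromℕ (2 ℕ.* k ℕ.+ 1) ≡ fromℕ k + fromℕ k + 1ℚ
  fromℕ-double+1 k = trans (fromℕ-+ (2 ℕ.* k) 1) (cong (_+ 1ℚ)
    (trans (fromℕ-+ k (k ℕ.+ 0)) (cong (fromℕ k +_) (cong fromℕ (ℕ.+-identityʳ k)))))

  weight-suc : ∀ p k → let x = fromℕ k; P = fromℕ p + 1ℚ; d = (P + P + 1ℚ) * (P + P) in
    d * weight (suc p) k ≡ ((x + x + 1ℚ) * (x + x + 1ℚ) - P * P) * weight p k
  weight-suc p k = begin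
    (P + P + 1ℚ) * (P + P) * weight (suc p) k
      ≡⟨ cong₂ _*_
        (trans (solve 1 (λ p → let P = p :+ 𝟙 in
            (P :+ P :+ 𝟙) :* (P :+ P) := (p :+ p :+ 𝟙 :+ 𝟙 :+ 𝟙) :* (p :+ p :+ 𝟙 :+ 𝟙)) refl (fromℕ p))
          (cong (λ r → (r + 1ℚ + 1ℚ) * (r + 1ℚ)) (sym (fromℕ-double+1 p))))
        (cong₂ binom (ℕ.+-suc (2 ℕ.* k ℕ.+ 1) p) (cong (ℕ._+ 1) (cong suc (ℕ.+-suc p (p ℕ.+ 0))))) ⟩
    (fromℕ r + 1ℚ + 1ℚ) * (fromℕ r + 1ℚ) * binom (suc n) (suc (suc r))
      ≡⟨ binom-diagonal n r ⟩
    (fromℕ n + 1ℚ) * (fromℕ n - fromℕ r) * binom n r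
      ≡⟨ cong (_* binom n r) (cong₂ (λ n r → (n + 1ℚ) * (n - r))
           (trans (fromℕ-+ (2 ℕ.* k ℕ.+ 1) p) (cong (_+ fromℕ p) (fromℕ-double+1 k))) (fromℕ-double+1 p)) ⟩
    (x + x + 1ℚ + fromℕ p + 1ℚ) * (x + x + 1ℚ + fromℕ p - (fromℕ p + fromℕ p + 1ℚ)) * weight p k
      ≡⟨ cong (_* weight p k) (solve 2 (λ x p →
           (x :+ x :+ 𝟙 :+ p :+ 𝟙) :* (x :+ x :+ 𝟙 :+ p :- (p :+ p :+ 𝟙))
           := (x :+ x :+ 𝟙) :* (x :+ x :+ 𝟙) :- (p :+ 𝟙) :* (p :+ 𝟙)) refl x (fromℕ p)) ⟩
    ((x + x + 1ℚ) * (x + x + 1ℚ) - P * P) * weight p k ∎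
    where
    open ≡-Reasoning
    x = fromℕ k
    P = fromℕ p + 1ℚ
    n = 2 ℕ.* k ℕ.+ 1 ℕ.+ p
    r = 2 ℕ.* p ℕ.+ 1

  weight-denominator≢0 : ∀ p → let P = fromℕ p + 1ℚ in (P + P + 1ℚ) * (P + P) ≢ 0ℚ
  weight-denominator≢0 p = *-≢0
    (fromℕ-suc≢0 (suc p ℕ.+ suc p) ∘ trans (trans (fromℕ-suc (suc p ℕ.+ suc p)) (cong (_+ 1ℚ) 2P)))
    (fromℕ-suc≢0 (p ℕ.+ suc p) ∘ trans 2P)
    where
    2P : fromℕ (suc p ℕ.+ suc p) ≡ (fromℕ p + 1ℚ) + (fromℕ p + 1ℚ)
    2P = trans (fromℕ-+ (suc p) (suc p)) (cong₂ _+_ (fromℕ-suc p) (fromℕ-suc p))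

  NewtonWeight : ℕ → Set
  NewtonWeight p = ∃ λ as → length as ≡ suc p × nth 0ℚ as p ≢ 0ℚ ×
    (∀ k → let x = fromℕ k in (x + x + 1ℚ) * newton 0 as (x * x + x) ≡ weight p k)

  newton-weight-zero : NewtonWeight 0
  newton-weight-zero = 1ℚ ∷ [] , refl , 1≢0 , λ k → begin
    (fromℕ k + fromℕ k + 1ℚ) * (1ℚ + (fromℕ k * fromℕ k + fromℕ k - 0ℚ * (0ℚ + 1ℚ)) * 0ℚ)
      ≡⟨ solve 1 (λ x → (x :+ x :+ 𝟙) :* (𝟙 :+ (x :* x :+ x :- 𝟘 :* (𝟘 :+ 𝟙)) :* 𝟘) := x :+ x :+ 𝟙)
           refl (fromℕ k) ⟩
    fromℕ k + fromℕ k + 1ℚ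
      ≡⟨ fromℕ-double+1 k ⟨
    fromℕ (2 ℕ.* k ℕ.+ 1)
      ≡⟨ cong fromℕ (trans (nC1≡n (2 ℕ.* k ℕ.+ 1 ℕ.+ 0)) (ℕ.+-identityʳ (2 ℕ.* k ℕ.+ 1))) ⟨
    weight 0 k ∎
    where open ≡-Reasoning

  newton-weight-suc : ∀ p → NewtonWeight p → NewtonWeight (suc p)
  newton-weight-suc p (as , len , nz , eq) = mul-linear α β 0 0ℚ as
    , trans (length-mul-linear α β 0 0ℚ as) (cong suc len)
    , *-≢0 (*-≢0 (fromℕ-suc≢0 3) e≢0) nz ∘ trans (sym (mul-linear-leading α β 0 0ℚ as p len))
    , λ k → step (fromℕ k) (weight p k) (weight (suc p) k) (eq k) (weight-suc p k)
    where
    open ≡-Reasoning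
    P = fromℕ p + 1ℚ
    d = (P + P + 1ℚ) * (P + P)
    inv = inverse (weight-denominator≢0 p)
    e = proj₁ inv
    e≢0 = proj₂ (proj₂ inv)
    α = fromℕ 4 * e
    β = (1ℚ - P * P) * e
    step : ∀ x w w′ → (x + x + 1ℚ) * newton 0 as (x * x + x) ≡ w →
      d * w′ ≡ ((x + x + 1ℚ) * (x + x + 1ℚ) - P * P) * w →
      (x + x + 1ℚ) * newton 0 (mul-linear α β 0 0ℚ as) (x * x + x) ≡ w′
    step x w w′ eq rec = begin
      X * newton 0 (mul-linear α β 0 0ℚ as) (x * x + x)
        ≡⟨ cong (X *_) (newton-mul-linear α β 0 0ℚ as (x * x + x)) ⟩
      X * (0ℚ + (α * (x * x + x) + β) * A)
        ≡⟨ solve 4 (λ x P e A → let X = x :+ x :+ 𝟙 in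
             X :* (𝟘 :+ (con (ℤ.+ 4) :* e :* (x :* x :+ x) :+ (𝟙 :- P :* P) :* e) :* A)
             := e :* ((X :* X :- P :* P) :* (X :* A))) refl x P e A ⟩
      e * ((X * X - P * P) * (X * A))
        ≡⟨ cong (λ w → e * ((X * X - P * P) * w)) eq ⟩
      e * ((X * X - P * P) * w)
        ≡⟨ cong (e *_) rec ⟨
      e * (d * w′)
        ≡⟨ lincomb w′ (proj₁ (proj₂ inv)) (solve 3 (λ e d w → e :* (d :* w) :- w := w :* (d :* e :- 𝟙))
             refl e d w′) ⟩
      w′ ∎
      where
      X = x + x + 1ℚ
      A = newton 0 as (x * x + x)

  newton-weight : ∀ p → NewtonWeight p
  newton-weight zero    = newton-weight-zero
  newton-weight (suc p) = newton-weight-suc p (newton-weight p)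

  -- Telescoping

  telescope : ∀ (g : ℕ → ℤ.ℤ) (G : ℕ → ℚ) → (∀ i → fromℤ (g i) ≡ G i - G (suc i)) →
    ∀ n → fromℤ (foldr ℤ._+_ (ℤ.+ 0) (applyUpTo g n)) ≡ G 0 - G n
  telescope g G step zero    = sym (+-inverseʳ (G 0))
  telescope g G step (suc n) = begin
    fromℤ (g 0 ℤ.+ foldr ℤ._+_ (ℤ.+ 0) (applyUpTo (g ∘ suc) n))
      ≡⟨ fromℤ-+ (g 0) (foldr ℤ._+_ (ℤ.+ 0) (applyUpTo (g ∘ suc) n)) ⟩
    fromℤ (g 0) + fromℤ (foldr ℤ._+_ (ℤ.+ 0) (applyUpTo (g ∘ suc) n))
      ≡⟨ cong₂ _+_ (step 0) (telescope (g ∘ suc) (G ∘ suc) (step ∘ suc) n) ⟩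
    (G 0 - G 1) + (G 1 - G (suc n))
      ≡⟨ solve 3 (λ x y z → (x :- y) :+ (y :- z) := x :- z) refl (G 0) (G 1) (G (suc n)) ⟩
    G 0 - G (suc n) ∎
    where open ≡-Reasoning

  telescope-∑ : ∀ (f : ℕ → ℤ.ℤ) (F : ℕ → ℚ) → (∀ k → fromℤ (f k) ≡ F k - F (suc k)) →
    ∀ {lo hi} → lo ℕ.≤ hi → fromℤ (sum lo hi f) ≡ F lo - F hi
  telescope-∑ f F step {lo} {hi} lo≤hi = begin
    fromℤ (sum lo hi f)
      ≡⟨ telescope (λ i → f (lo ℕ.+ i)) (λ i → F (lo ℕ.+ i))
           (λ i → trans (step (lo ℕ.+ i)) (cong (λ k → F (lo ℕ.+ i) - F k) (sym (ℕ.+-suc lo i))))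
           (hi ℕ.∸ lo) ⟩
    F (lo ℕ.+ 0) - F (lo ℕ.+ (hi ℕ.∸ lo))
      ≡⟨ cong₂ (λ k l → F k - F l) (ℕ.+-identityʳ lo) (ℕ.m+[n∸m]≡n lo≤hi) ⟩
    F lo - F hi ∎
    where open ≡-Reasoning

  Recurrence : ℕ → Poly₂ → Set
  Recurrence p M = ∀ k y → let x = fromℕ k in
    (y + x) * eval M x y + (x + 1ℚ - y) * eval M (x + 1ℚ) y ≡ weight p k

  [b+j]·_ : Poly₂ → Poly₂
  [b+j]· M = b· M ⊞₂ j· M

  eval-[b+j]· : ∀ M x y → eval ([b+j]· M) x y ≡ (x + y) * eval M x y
  eval-[b+j]· M x y = begin
    eval (b· M ⊞₂ j· M) x y             ≡⟨ eval-⊞₂ (b· M) (j· M) x y ⟩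
    eval (b· M) x y + eval (j· M) x y   ≡⟨ cong₂ _+_ (eval-b· M x y) (eval-j· M x y) ⟩
    x * eval M x y + y * eval M x y     ≡⟨ *-distribʳ-+ (eval M x y) x y ⟨
    (x + y) * eval M x y                ∎
    where open ≡-Reasoning

  eval-[b+j]·-vanishes : ∀ M x → eval ([b+j]· M) x (- x) ≡ 0ℚ
  eval-[b+j]·-vanishes M x = trans (eval-[b+j]· M x (- x))
    (solve 2 (λ x v → (x :+ :- x) :* v := 𝟘) refl x (eval M x (- x)))

  identity₁ : ∀ p M → Recurrence p M → Identity₁ p ([b+j]· M)
  identity₁ p M rec b (suc j) b<j = begin
    fromℤ (sum b (suc j) f)
      ≡⟨ telescope-∑ f F step (ℕ.<⇒≤ b<j) ⟩
    F b - F (suc j)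
      ≡⟨ cong (λ c → F b - fromℕ c * eval Q (fromℕ (suc j)) y) (k>n⇒nCk≡0 top) ⟩
    F b - 0ℚ * eval Q (fromℕ (suc j)) y
      ≡⟨ solve 2 (λ u v → u :- 𝟘 :* v := u) refl (F b) (eval Q (fromℕ (suc j)) y) ⟩
    F b ∎
    where
    open ≡-Reasoning
    Q = [b+j]· M
    y = fromℕ (suc j)
    N = 2 ℕ.* suc j ℕ.∸ 1
    f : ℕ → ℤ.ℤ
    f k = ℤ.+ ((2 ℕ.* k ℕ.+ 1 ℕ.+ p) C (2 ℕ.* p ℕ.+ 1)) ℤ.* ℤ.+ (N C (suc j ℕ.+ k))
    F : ℕ → ℚ
    F k = binom N (suc j ℕ.+ k) * eval Q (fromℕ k) y
    top : N ℕ.< suc j ℕ.+ suc j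
    top = ℕ.≤-reflexive (cong (λ u → suc j ℕ.+ suc u) (ℕ.+-identityʳ j))
    N≡ : fromℕ N ≡ y + y - 1ℚ
    N≡ = begin
      fromℕ N                ≡⟨ solve 1 (λ n → n := n :+ 𝟙 :- 𝟙) refl (fromℕ N) ⟩
      fromℕ N + 1ℚ - 1ℚ      ≡⟨ cong (_- 1ℚ) (fromℕ-suc N) ⟨
      fromℕ (suc N) - 1ℚ     ≡⟨ cong (λ n → fromℕ n - 1ℚ) (cong (suc j ℕ.+_) (ℕ.+-identityʳ (suc j))) ⟩
      fromℕ (suc j ℕ.+ suc j) - 1ℚ ≡⟨ cong (_- 1ℚ) (fromℕ-+ (suc j) (suc j)) ⟩
      y + y - 1ℚ             ∎
    algebra : ∀ x β β′ w m m′ → (y + x + 1ℚ) * β′ ≡ (y + y - 1ℚ - (y + x)) * β →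
      (y + x) * m + (x + 1ℚ - y) * m′ ≡ w →
      w * β ≡ β * ((x + y) * m) - β′ * ((x + 1ℚ + y) * m′)
    algebra x β β′ w m m′ eq refl = lincomb m′ eq
      (solve 6 (λ x y β β′ m m′ →
        ((y :+ x) :* m :+ (x :+ 𝟙 :- y) :* m′) :* β :- (β :* ((x :+ y) :* m) :- β′ :* ((x :+ 𝟙 :+ y) :* m′))
        := m′ :* ((y :+ x :+ 𝟙) :* β′ :- (y :+ y :- 𝟙 :- (y :+ x)) :* β)) refl x y β β′ m m′)
    step : ∀ k → fromℤ (f k) ≡ F k - F (suc k)
    step k = begin
      fromℤ (f k)
        ≡⟨ fromℤ-* (ℤ.+ ((2 ℕ.* k ℕ.+ 1 ℕ.+ p) C (2 ℕ.* p ℕ.+ 1))) (ℤ.+ (N C (suc j ℕ.+ k))) ⟩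
      weight p k * binom N (suc j ℕ.+ k)
        ≡⟨ algebra x (binom N (suc j ℕ.+ k)) (binom N (suc (suc j ℕ.+ k))) (weight p k)
             (eval M x y) (eval M (x + 1ℚ) y)
             (subst₂ (λ n u → (u + 1ℚ) * binom N (suc (suc j ℕ.+ k)) ≡ (n - u) * binom N (suc j ℕ.+ k))
               N≡ (fromℕ-+ (suc j) k) (binom-sucʳ N (suc j ℕ.+ k)))
             (rec k y) ⟩
      binom N (suc j ℕ.+ k) * ((x + y) * eval M x y)
        - binom N (suc (suc j ℕ.+ k)) * ((x + 1ℚ + y) * eval M (x + 1ℚ) y)
        ≡⟨ cong₂ (λ u v → binom N (suc j ℕ.+ k) * u - v) (sym (eval-[b+j]· M x y))
             (cong₂ _*_ (cong (binom N) (sym (ℕ.+-suc (suc j) k)))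
               (trans (sym (eval-[b+j]· M (x + 1ℚ) y)) (cong (λ x → eval Q x y) (sym (fromℕ-suc k))))) ⟩
      F k - F (suc k) ∎
      where x = fromℕ k

  identity₂ : ∀ p M → Recurrence p M → Identity₂ p ([b+j]· M)
  identity₂ p M rec b m m<b = begin
    fromℤ (sum m b f)
      ≡⟨ telescope-∑ f F step (ℕ.<⇒≤ m<b) ⟩
    F m - F b
      ≡⟨ cong (λ u → sign m * binom (m ℕ.+ m) (2 ℕ.* m) * u - F b) (eval-[b+j]·-vanishes M (fromℕ m)) ⟩
    sign m * binom (m ℕ.+ m) (2 ℕ.* m) * 0ℚ - sign b * binom (b ℕ.+ m) (2 ℕ.* m) * q
      ≡⟨ solve 4 (λ u s c q → u :* 𝟘 :- s :* c :* q := :- s :* c :* q) refl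
           (sign m * binom (m ℕ.+ m) (2 ℕ.* m)) (sign b) (binom (b ℕ.+ m) (2 ℕ.* m)) q ⟩
    - sign b * binom (b ℕ.+ m) (2 ℕ.* m) * q
      ≡⟨ cong (_* q) (trans (cong (_* binom (b ℕ.+ m) (2 ℕ.* m)) (sym (fromℤ-neg (ℤ.-1ℤ ℤ.^ (b ℕ.+ m)))))
           (sym (fromℤ-* (ℤ.- (ℤ.-1ℤ ℤ.^ (b ℕ.+ m))) (ℤ.+ ((b ℕ.+ m) C (2 ℕ.* m)))))) ⟩
    fromℤ (ℤ.- (ℤ.-1ℤ ℤ.^ (b ℕ.+ m)) ℤ.* ℤ.+ ((b ℕ.+ m) C (2 ℕ.* m))) * q ∎
    where
    open ≡-Reasoning
    Q = [b+j]· M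
    y = - fromℕ m
    q = eval Q (fromℕ b) y
    f : ℕ → ℤ.ℤ
    f k = ℤ.+ ((2 ℕ.* k ℕ.+ 1 ℕ.+ p) C (2 ℕ.* p ℕ.+ 1)) ℤ.* ℤ.-1ℤ ℤ.^ (k ℕ.+ m) ℤ.* ℤ.+ ((k ℕ.+ m) C (2 ℕ.* m))
    sign : ℕ → ℚ
    sign k = fromℤ (ℤ.-1ℤ ℤ.^ (k ℕ.+ m))
    F : ℕ → ℚ
    F k = sign k * binom (k ℕ.+ m) (2 ℕ.* m) * eval Q (fromℕ k) y
    algebra : ∀ x z s β β′ w r r′ → (x + z + 1ℚ - (z + z)) * β′ ≡ (x + z + 1ℚ) * β →
      (- z + x) * r + (x + 1ℚ - - z) * r′ ≡ w →
      w * s * β ≡ s * β * ((x + - z) * r) - - 1ℚ * s * β′ * ((x + 1ℚ + - z) * r′)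
    algebra x z s β β′ w r r′ eq refl = lincomb (- (s * r′)) eq
      (solve 7 (λ x z s β β′ r r′ →
        ((:- z :+ x) :* r :+ (x :+ 𝟙 :- :- z) :* r′) :* s :* β
          :- (s :* β :* ((x :+ :- z) :* r) :- con ℤ.-1ℤ :* s :* β′ :* ((x :+ 𝟙 :+ :- z) :* r′))
        := :- (s :* r′) :* ((x :+ z :+ 𝟙 :- (z :+ z)) :* β′ :- (x :+ z :+ 𝟙) :* β)) refl x z s β β′ r r′)
    2m≡ : fromℕ (2 ℕ.* m) ≡ fromℕ m + fromℕ m
    2m≡ = trans (cong (λ u → fromℕ (m ℕ.+ u)) (ℕ.+-identityʳ m)) (fromℕ-+ m m)
    step : ∀ k → fromℤ (f k) ≡ F k - F (suc k)
    step k = begin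
      fromℤ (f k)
        ≡⟨ trans (fromℤ-* (c ℤ.* ℤ.-1ℤ ℤ.^ (k ℕ.+ m)) (ℤ.+ ((k ℕ.+ m) C (2 ℕ.* m))))
             (cong (_* β) (fromℤ-* c (ℤ.-1ℤ ℤ.^ (k ℕ.+ m)))) ⟩
      weight p k * sign k * β
        ≡⟨ algebra x (fromℕ m) (sign k) β β′ (weight p k) (eval M x y) (eval M (x + 1ℚ) y)
             (subst₂ (λ n u → (n + 1ℚ - u) * β′ ≡ (n + 1ℚ) * β) (fromℕ-+ k m) 2m≡
               (binom-sucˡ (k ℕ.+ m) (2 ℕ.* m)))
             (rec k y) ⟩
      sign k * β * ((x + y) * eval M x y) - - 1ℚ * sign k * β′ * ((x + 1ℚ + y) * eval M (x + 1ℚ) y)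
        ≡⟨ cong₂ (λ u v → sign k * β * u - v) (sym (eval-[b+j]· M x y))
             (cong₂ (λ s v → s * β′ * v) (sym (fromℤ-* ℤ.-1ℤ (ℤ.-1ℤ ℤ.^ (k ℕ.+ m))))
               (trans (sym (eval-[b+j]· M (x + 1ℚ) y)) (cong (λ x → eval Q x y) (sym (fromℕ-suc k))))) ⟩
      F k - F (suc k) ∎
      where
      x = fromℕ k
      c = ℤ.+ ((2 ℕ.* k ℕ.+ 1 ℕ.+ p) C (2 ℕ.* p ℕ.+ 1))
      β = binom (k ℕ.+ m) (2 ℕ.* m)
      β′ = binom (suc (k ℕ.+ m)) (2 ℕ.* m)

  k≤n⇒nCk≢0 : ∀ {n k} → k ℕ.≤ n → n C k ≢ 0
  k≤n⇒nCk≢0 {n}             z≤n       ()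
  k≤n⇒nCk≢0 {suc n} {suc k} (s≤s k≤n) eq = k≤n⇒nCk≢0 k≤n
    (ℕ.m+n≡0⇒m≡0 (n C k) (trans (nCk+nC[k+1]≡[n+1]C[k+1] n k) eq))

  Identity₁-unique : ∀ p Q Q′ → Identity₁ p Q → Identity₁ p Q′ → Q ≈ Q′
  Identity₁-unique p Q Q′ id id′ = eventually-equal Q Q′ λ b j b<j →
    *-cancelˡ-≢0 (binom≢0 b j b<j) (trans (sym (id b j b<j)) (id′ b j b<j))
    where
    binom≢0 : ∀ b j → b ℕ.< j → binom (2 ℕ.* j ℕ.∸ 1) (j ℕ.+ b) ≢ 0ℚ
    binom≢0 b (suc j) (s≤s b≤j) eq = k≤n⇒nCk≢0
      (ℕ.≤-trans (ℕ.≤-reflexive (sym (ℕ.+-suc j b)))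
        (ℕ.+-monoʳ-≤ j (s≤s (ℕ.≤-trans b≤j (ℕ.≤-reflexive (sym (ℕ.+-identityʳ j)))))))
      (fromℕ-injective eq)

  solution-Degree-b : ∀ p as → length as ≡ suc p → nth 0ℚ as p ≢ 0ℚ →
    Degree-b ([b+j]· solution 0 as) (2 ℕ.* p ℕ.+ 1)
  solution-Degree-b p as len nz = (0 , λ eq → nz (begin
      nth 0ℚ as p                                       ≡⟨ solution-leading-b 0 as p len ⟨
      coeff M (p ℕ.+ p) 0                               ≡⟨ +-identityʳ _ ⟨
      coeff M (p ℕ.+ p) 0 + 0ℚ                          ≡⟨ cong (coeff M (p ℕ.+ p) 0 +_)
                                                             (coeff-j·-zero M (suc (p ℕ.+ p))) ⟨
      coeff M (p ℕ.+ p) 0 + coeff (j· M) (suc (p ℕ.+ p)) 0  ≡⟨ coeff-⊞₂ (b· M) (j· M) (suc (p ℕ.+ p)) 0 ⟨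
      coeff Q (suc (p ℕ.+ p)) 0                         ≡⟨ cong (λ r → coeff Q r 0) 2p+1≡ ⟨
      coeff Q (2 ℕ.* p ℕ.+ 1) 0                         ≡⟨ eq ⟩
      0ℚ                                                ∎))
    , λ { (suc r) s bound → high r s (ℕ.≤-pred (subst (ℕ._< suc r) 2p+1≡ bound)) }
    where
    open ≡-Reasoning
    M = solution 0 as
    Q = [b+j]· M
    2p+1≡ : 2 ℕ.* p ℕ.+ 1 ≡ suc (p ℕ.+ p)
    2p+1≡ = trans (ℕ.+-comm (2 ℕ.* p) 1) (cong (λ u → suc (p ℕ.+ u)) (ℕ.+-identityʳ p))
    2len≡ : length as ℕ.+ length as ≡ suc (suc (p ℕ.+ p))
    2len≡ = trans (cong₂ ℕ._+_ len len) (cong suc (ℕ.+-suc p p))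
    high-j : ∀ r s → suc (p ℕ.+ p) ℕ.≤ r → coeff (j· M) (suc r) s ≡ 0ℚ
    high-j r zero    _  = coeff-j·-zero M (suc r)
    high-j r (suc s) le = trans (coeff-j·-suc M (suc r) s)
      (solution-degree-b 0 as (suc r) s (ℕ.≤-trans (ℕ.≤-reflexive 2len≡) (ℕ.m≤n⇒m≤1+n (s≤s le))))
    high : ∀ r s → suc (p ℕ.+ p) ℕ.≤ r → coeff Q (suc r) s ≡ 0ℚ
    high r s le = trans (coeff-⊞₂ (b· M) (j· M) (suc r) s)
      (cong₂ _+_ (solution-degree-b 0 as r s (ℕ.≤-trans (ℕ.≤-reflexive 2len≡) (s≤s le))) (high-j r s le))

  solution-Degree-j : ∀ p as → length as ≡ suc p → nth 0ℚ as p ≢ 0ℚ →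
    Degree-j ([b+j]· solution 0 as) (p ℕ.+ 1)
  solution-Degree-j p as len nz = (0 , λ eq → remainder-leading 0 as p len nz (begin
      nth 0ℚ (remainder 0 as) p  ≡⟨ coeff-solution-0 as p ⟨
      coeff M 0 p                ≡⟨ coeff-j·-suc M 0 p ⟨
      coeff (j· M) 0 (suc p)     ≡⟨ +-identityˡ _ ⟨
      0ℚ + coeff (j· M) 0 (suc p)  ≡⟨ coeff-⊞₂ (b· M) (j· M) 0 (suc p) ⟨
      coeff Q 0 (suc p)          ≡⟨ cong (coeff Q 0) (ℕ.+-comm p 1) ⟨
      coeff Q 0 (p ℕ.+ 1)        ≡⟨ eq ⟩
      0ℚ                         ∎))
    , λ { r (suc s) bound → trans (coeff-⊞₂ (b· M) (j· M) r (suc s))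
          (high r s (ℕ.≤-pred (subst (ℕ._< suc s) (ℕ.+-comm p 1) bound))) }
    where
    open ≡-Reasoning
    M = solution 0 as
    Q = [b+j]· M
    high : ∀ r s → suc p ℕ.≤ s → coeff (b· M) r (suc s) + coeff (j· M) r (suc s) ≡ 0ℚ
    high r s le = cong₂ _+_ (high-b r)
      (trans (coeff-j·-suc M r s) (solution-degree-j 0 as r s (ℕ.≤-trans (ℕ.≤-reflexive len) le)))
      where
      high-b : ∀ r → coeff (b· M) r (suc s) ≡ 0ℚ
      high-b zero    = refl
      high-b (suc r) = solution-degree-j 0 as r (suc s) (ℕ.≤-trans (ℕ.≤-reflexive len) (ℕ.m≤n⇒m≤1+n le))

open import Data.Nat using (_+_; _*_)

lemma7 : ∀ (p : ℕ) →
    Σ[ (Q , _) ∈ ∃! _≈_ (λ Q → Identity₁ p Q × Identity₂ p Q) ]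
    ( Degree-b Q (2 * p + 1)
    × Degree-j Q (p + 1)
    × (∀ (b : ℚ) → eval Q b (- b) ≡ 0ℚ) )
lemma7 p =
  let as , len , nz , newton≡weight = newton-weight p
      M   = solution 0 as
      rec = λ k y → trans (solution-recurrence as (fromℕ k) y) (newton≡weight k)
      id₁ = identity₁ p M rec
  in ([b+j]· M , (id₁ , identity₂ p M rec) , λ {Q′} (id₁′ , _) → Identity₁-unique p ([b+j]· M) Q′ id₁ id₁′)
   , solution-Degree-b p as len nz
   , solution-Degree-j p as len nz
   , eval-[b+j]·-vanishes M
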